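{- Let $\ell>2$ be a natural number. Then Henson's universal $K_\ell$-free graph $\mathbf H_\ell$ is not finitely retractable.
   Context: A graph is a pair $G=(V,E)$ where $E$ is a symmetric and reflexive binary relation on $V$ (every vertex has a loop). A graph homomorphism is an edge-preserving map (so distinct adjacent vertices may be mapped to the same vertex). $K_n$ is the complete graph with $n$ vertices; a graph is $K_n$-free if it does not contain $n$ distinct pairwise adjacent vertices. $\mathbf H_n$ (Henson's universal $K_n$-free graph) is the Fraïssé limit of the class of finite $K_n$-free graphs: the unique (up to isomorphism) countable $K_n$-free graph which contains an isomorphic copy (as induced subgraph) of every countable $K_n$-free graph and is homogeneous, i.e. every isomorphism between finite induced subgraphs extends to an automorphism. A retraction of a graph $X$ is a homomorphism $r\colon X\to X$ that is the identity on its range. A graph $X$ is finitely retractable if for every finite $F\subseteq X$ there is a retraction $r\colon X\to X$ with $F\subseteq r[X]$ and $r[X]$ finite. -}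

module Defs where

open import Level using (0ℓ)
open import Data.Nat.Base using (ℕ)
open import Data.Fin.Base using (Fin)
open import Data.List.Base using (List)
open import Data.List.Membership.Propositional using (_∈_)
open import Data.Maybe.Base using (Maybe)
open import Data.Product.Base using (Σ-syntax; ∃-syntax; _×_)
open import Function.Base using (_on_)
open import Function.Bundles using (_⇔_; _↔_; _↠_; _↣_; Inverse; Injection)
open import Function.Definitions using (Injective)
open import Relation.Binary.Core using (Rel)
open import Relation.Binary.Definitions using (Reflexive; Symmetric; Decidable)
open import Relation.Binary.PropositionalEquality.Core using (_≡_)
open import Relation.Nullary.Negation.Core using (¬_)
open import Relation.Unary using (Pred; _⊆_)

record Graph : Set₁ where
  field
    V      : Set
    E      : Rel V 0ℓ
    E-refl : Reflexive E
    E-sym  : Symmetric E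

open Graph public

record Hom (G H : Graph) : Set where
  field
    map      : V G → V H
    preserve : ∀ {x y} → E G x y → E H (map x) (map y)

-- An isomorphism from G onto an induced subgraph of H.
record Embedding (G H : Graph) : Set where
  field
    injection : V G ↣ V H
    edges     : ∀ x y → E G x y ⇔ E H (Injection.to injection x) (Injection.to injection y)

record Iso (G H : Graph) : Set where
  field
    bijection : V G ↔ V H
    edges     : ∀ x y → E G x y ⇔ E H (Inverse.to bijection x) (Inverse.to bijection y)

  to : V G → V H
  to = Inverse.to bijection

KFree : ℕ → Graph → Set
KFree n G = ¬ (Σ[ f ∈ (Fin n → V G) ] Injective _≡_ _≡_ f × (∀ i j → E G (f i) (f j)))

-- Finite sets are countable; Maybe makes room for them, the empty set included.
Countable : Set → Set
Countable A = ℕ ↠ Maybe A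

-- A finite induced subgraph is given by an injective enumeration of its
-- vertices; its own vertex type is then Fin n.
induced : (G : Graph) {A : Set} (f : A ↣ V G) → Graph
induced G {A} f = record
  { V      = A
  ; E      = E G on Injection.to f
  ; E-refl = E-refl G
  ; E-sym  = E-sym G
  }

Homogeneous : Graph → Set
Homogeneous G =
  ∀ {m n} (f : Fin m ↣ V G) (g : Fin n ↣ V G) (φ : Iso (induced G f) (induced G g)) →
  Σ[ α ∈ Iso G G ] (∀ i → Iso.to α (Injection.to f i) ≡ Injection.to g (Iso.to φ i))

-- Decidability of adjacency is automatic classically. Asking for it here only
-- weakens the notion of universality, and it is what makes the usual
-- vertex-by-vertex embedding argument work constructively.
Universal : ℕ → Graph → Set₁
Universal n H =
  (G : Graph) → Countable (V G) → Decidable (E G) → KFree n G → Embedding G H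

-- H is (a copy of) Henson's graph: these properties determine it up to isomorphism.
record IsHenson (n : ℕ) (H : Graph) : Set₁ where
  field
    countable   : Countable (V H)
    free        : KFree n H
    universal   : Universal n H
    homogeneous : Homogeneous H

record Retraction (G : Graph) : Set where
  field
    hom        : Hom G G
    idempotent : ∀ x → Hom.map hom (Hom.map hom x) ≡ Hom.map hom x

  range : Pred (V G) 0ℓ
  range y = ∃[ x ] Hom.map hom x ≡ y

Finite : {A : Set} → Pred A 0ℓ → Set
Finite {A} P = Σ[ xs ∈ List A ] (∀ x → P x ⇔ x ∈ xs)

FinitelyRetractable : Graph → Set₁
FinitelyRetractable G =
  (F : Pred (V G) 0ℓ) → Finite F →
  Σ[ r ∈ Retraction G ] F ⊆ Retraction.range r × Finite (Retraction.range r)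

{-# OPTIONS --safe #-}

-- Write l = m + 1 and let F ⊆ H be a disjoint union of blocks, each an
-- m-clique. As H is K_l-free, every vertex misses (is non-adjacent to) some
-- vertex of any given pair of blocks. Let r be a retraction with finite range
-- R ⊇ F. Vertices a₁, …, a_m outside R are found one at a time, pairwise
-- non-adjacent but with r a₁, …, r a_m an m-clique: for k < m choose zᵢ ∈ F
-- missing r aᵢ and a new vertex x adjacent, among R and the aᵢ, precisely to the
-- r aᵢ and the zᵢ (i ≤ k). By pigeonhole an m-clique among these 2k vertices
-- would contain both r aᵢ and zᵢ for some i, so x exists. Its image is adjacent
-- to all r aᵢ and, because of zᵢ, distinct from them. At k = m the same is done
-- with aᵢ in place of r aᵢ and with the zᵢ in new, distinct blocks. There aᵢ can
-- only be adjacent to those zⱼ that are some r aₕ, and none is, because zⱼ misses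
-- r aⱼ. So the aᵢ and zᵢ are independent, a common neighbour x exists, and
-- r x, r a₁, …, r a_m is a K_l in H.

module Submission where

open import Data.Bool.Base using (Bool; true; false)
import Data.Bool.Properties as Bool
open import Data.Empty using (⊥)
open import Data.Fin.Base using (Fin; zero; suc; punchIn; punchOut)
open import Data.Fin.Properties
  using (_≟_; any?; <⇒≢; pigeonhole; punchIn-injective; punchInᵢ≢i; punchOut-injective;
         sequence; 0≢1+n)
  renaming (suc-injective to Fin-suc-injective)
open import Data.List.Base using (List; []; _∷_; _++_; map; allFin; tabulate; cartesianProduct)
open import Data.List.Membership.Propositional using (_∈_)
open import Data.List.Membership.Propositional.Properties
  using (∈-allFin; ∈-cartesianProduct⁺; ∈-map⁺; ∈-++⁺ˡ; ∈-++⁺ʳ; ∈-tabulate⁺)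
open import Data.List.Relation.Unary.Any using (here; there)
open import Data.Maybe.Base using (Maybe; just; nothing)
open import Data.Nat.Base using (ℕ; zero; suc; _<_; _≤_; s≤s)
open import Data.Nat.Properties using (n<1+n; <⇒≤; ≤-refl)
open import Data.Product.Base using (Σ-syntax; ∃-syntax; ∃₂; _×_; _,_; proj₁; proj₂)
open import Data.Product.Properties using (≡-dec)
open import Data.Sum.Base using (_⊎_; inj₁; inj₂)
open import Data.Unit.Base using (⊤; tt)
import Data.Vec.Functional as Vector
open import Effect.Monad using (RawMonad)
open import Function.Base using (_∘_; id)
open import Function.Bundles using (_⇔_; _↣_; Equivalence; Injection; mk⇔; mk↣; mk↔ₛ′; mk↠ₛ)
open import Function.Definitions using (Injective)
import Function.Properties.Inverse as Inv
open import Level using (0ℓ)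
open import Relation.Binary.Core using (Rel)
open import Relation.Binary.Definitions using (Symmetric; Decidable)
open import Relation.Binary.PropositionalEquality
  using (_≡_; _≢_; refl; sym; trans; cong; cong₂; subst; subst₂; ≢-sym)
open import Relation.Nullary.Decidable
  using (Dec; yes; no; decidable-stable; ¬¬-excluded-middle)
open import Relation.Nullary.Negation using (¬_; contradiction; ¬¬-Monad)
open import Relation.Unary using (Pred)
open import Defs

open Equivalence using () renaming (to to ⇒; from to ⇐)
open Injection using (injective) renaming (to to _⟨$⟩_)

-- Double negation, finite enumerations and pairwise relations.

private
  variable
    A : Set
    m n : ℕ

-- The final goal is `⊥`, so finitely many classical choices may be made at once under a double
-- negation.
¬¬-∀Fin : {P : Pred (Fin n) 0ℓ} → (∀ i → ¬ ¬ P i) → ¬ ¬ (∀ i → P i)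
¬¬-∀Fin = sequence (RawMonad.rawApplicative ¬¬-Monad)

nth : List A → ℕ → Maybe A
nth []       _       = nothing
nth (x ∷ xs) zero    = just x
nth (x ∷ xs) (suc n) = nth xs n

nth-beyond : (xs : List A) → ∃[ n ] nth xs n ≡ nothing
nth-beyond []       = 0 , refl
nth-beyond (x ∷ xs) with n , eq ← nth-beyond xs = suc n , eq

nth-∈ : {x : A} {xs : List A} → x ∈ xs → ∃[ n ] nth xs n ≡ just x
nth-∈ (here refl) = 0 , refl
nth-∈ (there x∈)  with n , eq ← nth-∈ x∈ = suc n , eq

listed⇒Countable : (xs : List A) → (∀ x → x ∈ xs) → Countable A
listed⇒Countable xs all = mk↠ₛ {to = nth xs} λ where
  nothing  → nth-beyond xs
  (just x) → nth-∈ (all x)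

Pairwise : Rel A 0ℓ → (Fin n → A) → Set
Pairwise _~_ f = ∀ i j → i ≢ j → f i ~ f j

pairwise-∷ : {_~_ : Rel A 0ℓ} → Symmetric _~_ → (x : A) (f : Fin n → A) →
             (∀ i → x ~ f i) → Pairwise _~_ f → Pairwise _~_ (x Vector.∷ f)
pairwise-∷ ~-sym x f x~f f~f zero    zero    i≢j = contradiction refl i≢j
pairwise-∷ ~-sym x f x~f f~f zero    (suc j) i≢j = x~f j
pairwise-∷ ~-sym x f x~f f~f (suc i) zero    i≢j = ~-sym (x~f i)
pairwise-∷ ~-sym x f x~f f~f (suc i) (suc j) i≢j = f~f i j (i≢j ∘ cong suc)

-- Discarding repetitions needs to decide membership, whence the double negation. Homogeneity
-- requires injective enumerations.
¬¬-enumerate : (xs : List A) →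
               ¬ ¬ (Σ[ n ∈ ℕ ] Σ[ f ∈ (Fin n ↣ A) ] (∀ x → x ∈ xs → ∃[ i ] f ⟨$⟩ i ≡ x))
¬¬-enumerate []       k = k (0 , mk↣ {to = λ ()} (λ {}) , λ _ ())
¬¬-enumerate {A} (x ∷ xs) k =
  ¬¬-enumerate xs λ (n , f , f-onto) → ¬¬-excluded-middle λ where
    (yes x∈f) → k (n , f , λ where
      _ (here refl) → x∈f
      y (there y∈)  → f-onto y y∈)
    (no x∉f) → k (suc n , mk↣ (∷-injective f x∉f) , λ where
      _ (here refl) → zero , refl
      y (there y∈)  → let i , eq = f-onto y y∈ in suc i , eq)
  where
  ∷-injective : (f : Fin n ↣ A) → ¬ (∃[ i ] f ⟨$⟩ i ≡ x) →
                Injective _≡_ _≡_ (x Vector.∷ (f ⟨$⟩_))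
  ∷-injective f x∉f {zero}  {zero}  _  = refl
  ∷-injective f x∉f {zero}  {suc j} eq = contradiction (j , sym eq) x∉f
  ∷-injective f x∉f {suc i} {zero}  eq = contradiction (i , eq) x∉f
  ∷-injective f x∉f {suc i} {suc j} eq = cong suc (injective f eq)

-- Cliques without loops, and one-point extensions.

Adjacent : (G : Graph) → Rel (V G) 0ℓ
Adjacent G x y = x ≢ y × E G x y

Adjacent-sym : (G : Graph) → Symmetric (Adjacent G)
Adjacent-sym G (x≢y , xy) = ≢-sym x≢y , E-sym G xy

KFree⇒no-clique : (G : Graph) → KFree n G → {f : Fin n → V G} → ¬ Pairwise (Adjacent G) f
KFree⇒no-clique G free {f} clique = free (f , inj , adj)
  where
  inj : Injective _≡_ _≡_ f
  inj {i} {j} eq = decidable-stable (i ≟ j) λ i≢j → proj₁ (clique i j i≢j) eq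

  adj : ∀ i j → E G (f i) (f j)
  adj i j with i ≟ j
  ... | yes refl = E-refl G
  ... | no  i≢j  = proj₂ (clique i j i≢j)

no-clique⇒KFree : (G : Graph) → (∀ f → ¬ Pairwise (Adjacent G) f) → KFree n G
no-clique⇒KFree G none (f , inj , adj) = none f λ i j i≢j → i≢j ∘ inj , adj i j

CliqueFree : (G : Graph) → ℕ → Pred (V G) 0ℓ → Set
CliqueFree G n S = ∀ (f : Fin n → V G) → (∀ i → S (f i)) → ¬ Pairwise (Adjacent G) f

module OnePointExtension (G : Graph) (f : Fin n ↣ V G) (S : Pred (V G) 0ℓ) where

  -- Here `zero` is the new vertex, and `suc i` stands for the `i`-th vertex of `f`.
  E⁺ : Rel (Fin (suc n)) 0ℓ
  E⁺ zero    zero    = ⊤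
  E⁺ zero    (suc j) = S (f ⟨$⟩ j)
  E⁺ (suc i) zero    = S (f ⟨$⟩ i)
  E⁺ (suc i) (suc j) = E G (f ⟨$⟩ i) (f ⟨$⟩ j)

  E⁺-sym : Symmetric E⁺
  E⁺-sym {zero}  {zero}  _ = tt
  E⁺-sym {zero}  {suc j} s = s
  E⁺-sym {suc i} {zero}  s = s
  E⁺-sym {suc i} {suc j} e = E-sym G e

  E⁺-refl : ∀ {i} → E⁺ i i
  E⁺-refl {zero}  = tt
  E⁺-refl {suc i} = E-refl G

  graph : Graph
  graph = record { V = Fin (suc n) ; E = E⁺ ; E-refl = λ {i} → E⁺-refl {i}
                 ; E-sym = λ {i} {j} → E⁺-sym {i} {j} }

  E⁺? : (∀ i → Dec (S (f ⟨$⟩ i))) → (∀ i j → Dec (E G (f ⟨$⟩ i) (f ⟨$⟩ j))) → Decidable E⁺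
  E⁺? S? E? zero    zero    = yes tt
  E⁺? S? E? zero    (suc j) = S? j
  E⁺? S? E? (suc i) zero    = S? i
  E⁺? S? E? (suc i) (suc j) = E? i j

  old : {v : Fin (suc n)} → zero ≢ v → V G
  old 0≢v = f ⟨$⟩ punchOut 0≢v

  old-E : ∀ {u v} (0≢u : zero ≢ u) (0≢v : zero ≢ v) → E⁺ u v → E G (old 0≢u) (old 0≢v)
  old-E {zero}          0≢u 0≢v _ = contradiction refl 0≢u
  old-E {suc u} {zero}  0≢u 0≢v _ = contradiction refl 0≢v
  old-E {suc u} {suc v} 0≢u 0≢v e = e

  old-S : ∀ {v} (0≢v : zero ≢ v) → E⁺ zero v → S (old 0≢v)
  old-S {zero}  0≢v _ = contradiction refl 0≢v
  old-S {suc v} 0≢v s = s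

  old-clique : (g : Fin m → Fin (suc n)) (0≢g : ∀ i → zero ≢ g i) →
               Pairwise (Adjacent graph) g → Pairwise (Adjacent G) (λ i → old (0≢g i))
  old-clique g 0≢g clique i j i≢j =
    proj₁ (clique i j i≢j) ∘ punchOut-injective (0≢g i) (0≢g j) ∘ injective f ,
    old-E (0≢g i) (0≢g j) (proj₂ (clique i j i≢j))

  -- A clique avoiding the new vertex already lies in `G`; removing the new vertex from any other
  -- leaves an `m`-clique inside `S`.
  graph-free : KFree (suc m) G → CliqueFree G m S → KFree (suc m) graph
  graph-free {m} free S-free = no-clique⇒KFree graph λ g clique →
    case-apex g clique (any? λ i → zero ≟ g i)
    where
    case-apex : (g : Fin (suc m) → Fin (suc n)) → Pairwise (Adjacent graph) g →
                Dec (∃[ i ] zero ≡ g i) → ⊥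
    case-apex g clique (no 0∉g) =
      KFree⇒no-clique G free (old-clique g (λ i 0≡gi → 0∉g (i , 0≡gi)) clique)
    case-apex g clique (yes (i₀ , 0≡gi₀)) =
      S-free (λ i → old (0≢g i)) (λ i → old-S (0≢g i) (apexE i))
        (old-clique (g ∘ punchIn i₀) 0≢g
          λ i j i≢j → clique _ _ (i≢j ∘ punchIn-injective i₀ i j))
      where
      apex : ∀ i → Adjacent graph zero (g (punchIn i₀ i))
      apex i = subst (λ v → Adjacent graph v (g (punchIn i₀ i))) (sym 0≡gi₀)
                 (clique _ _ (≢-sym (punchInᵢ≢i i₀ i)))
      0≢g : ∀ i → zero ≢ g (punchIn i₀ i)
      0≢g i = proj₁ (apex i)
      apexE : ∀ i → E⁺ zero (g (punchIn i₀ i))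
      apexE i = proj₂ (apex i)

  -- The embedding may place the old vertices anywhere. Homogeneity gives an automorphism carrying
  -- them back to `f`, and it carries the new vertex to `x`.
  realize : Homogeneous G → Embedding graph G →
            ∃[ x ] (∀ i → x ≢ f ⟨$⟩ i × (E G x (f ⟨$⟩ i) ⇔ S (f ⟨$⟩ i)))
  realize homogeneous emb = α (e zero) , λ i →
      (λ eq → 0≢1+n (injective ι (injective α↣ (trans eq (sym (α-f i)))))) ,
      mk⇔ (λ E-xf → ⇐ (Embedding.edges emb zero (suc i))
                      (⇐ (Iso.edges iso _ _) (subst (E G _) (sym (α-f i)) E-xf)))
          (λ s → subst (E G _) (α-f i) (⇒ (Iso.edges iso _ _) (⇒ (Embedding.edges emb zero (suc i)) s)))
    where
    ι : Fin (suc n) ↣ V G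
    ι = Embedding.injection emb
    e : Fin (suc n) → V G
    e = ι ⟨$⟩_
    copy : Fin n ↣ V G
    copy = mk↣ {to = e ∘ suc} (Fin-suc-injective ∘ injective ι)
    φ : Iso (induced G copy) (induced G f)
    φ = record
      { bijection = mk↔ₛ′ id id (λ _ → refl) (λ _ → refl)
      ; edges     = λ i j → mk⇔ (⇐ (Embedding.edges emb (suc i) (suc j)))
                                (⇒ (Embedding.edges emb (suc i) (suc j)))
      }
    extended : Σ[ α ∈ Iso G G ] (∀ i → Iso.to α (e (suc i)) ≡ f ⟨$⟩ i)
    extended = homogeneous copy f φ
    iso : Iso G G
    iso = proj₁ extended
    α : V G → V G
    α = Iso.to iso
    α↣ : V G ↣ V G
    α↣ = Inv.↔⇒↣ (Iso.bijection iso)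
    α-f : ∀ i → α (e (suc i)) ≡ f ⟨$⟩ i
    α-f = proj₂ extended

-- The extension property of Henson's graph.

module _ {m : ℕ} {H : Graph} (henson : IsHenson (suc m) H) where

  open IsHenson henson

  -- Universality asks for decidable adjacency; on the finitely many vertices of `ys` it is
  -- available under a double negation.
  ¬¬-extension : (S : Pred (V H) 0ℓ) → CliqueFree H m S → (ys : List (V H)) →
                 ¬ ¬ (∃[ x ] (∀ {y} → y ∈ ys → x ≢ y × (E H x y ⇔ S y)))
  ¬¬-extension S S-free ys k =
    ¬¬-enumerate ys λ (n , f , f-onto) →
    ¬¬-∀Fin (λ i → ¬¬-excluded-middle {A = S (f ⟨$⟩ i)}) λ S? →
    ¬¬-∀Fin (λ i → ¬¬-∀Fin (λ j → ¬¬-excluded-middle {A = E H (f ⟨$⟩ i) (f ⟨$⟩ j)})) λ E? →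
    let open OnePointExtension H f S
        x , x-f = realize homogeneous
          (universal graph (listed⇒Countable (allFin _) ∈-allFin) (E⁺? S? E?) (graph-free free S-free))
    in k (x , λ {y} y∈ys → let i , fi≡y = f-onto y y∈ys in
              subst (λ y → x ≢ y × (E H x y ⇔ S y)) fi≡y (x-f i))

-- Disjoint unions of cliques, and their copy in Henson's graph.

Blocks : Set → ℕ → Graph
Blocks J m = record
  { V = J × Fin m ; E = λ u v → proj₁ u ≡ proj₁ v ; E-refl = refl ; E-sym = sym }

-- Two of the `suc m` vertices share their position; being adjacent they also share their block, so
-- they coincide.
Blocks-free : (J : Set) → KFree (suc m) (Blocks J m)
Blocks-free {m} J (f , inj , adj)
  with i , j , i<j , eq ← pigeonhole (n<1+n m) (proj₂ ∘ f) =
  <⇒≢ i<j (inj (cong₂ _,_ (adj i j) eq))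

bools : List Bool
bools = false ∷ true ∷ []

∈-bools : ∀ b → b ∈ bools
∈-bools false = here refl
∈-bools true  = there (here refl)

module Contradiction
  {m : ℕ} (2≤m : 2 ≤ m) {H : Graph} (henson : IsHenson (suc m) H)
  where

  open IsHenson henson

  -- The pair of blocks zero serves the construction of the aᵢ, and the pair
  -- suc i provides zᵢ in the last step.
  J : Set
  J = Fin (suc m) × Bool

  vertices : List (J × Fin m)
  vertices = cartesianProduct (cartesianProduct (allFin _) bools) (allFin _)

  ∈-vertices : ∀ v → v ∈ vertices
  ∈-vertices ((t , b) , u) =
    ∈-cartesianProduct⁺ (∈-cartesianProduct⁺ (∈-allFin t) (∈-bools b)) (∈-allFin u)

  embedding : Embedding (Blocks J m) H
  embedding = universal (Blocks J m) (listed⇒Countable vertices ∈-vertices)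
    (λ u v → ≡-dec _≟_ Bool._≟_ (proj₁ u) (proj₁ v)) (Blocks-free J)

  open Embedding embedding using (injection; edges)

  β : J × Fin m → V H
  β = injection ⟨$⟩_

  -- Otherwise `q` and the block would form a clique on `suc m` vertices.
  ¬¬-in-block : ∀ {q} j → (∀ u → E H q (β (j , u))) → ¬ ¬ (∃[ u ] q ≡ β (j , u))
  ¬¬-in-block {q} j q-all q∉ = KFree⇒no-clique H free
    (pairwise-∷ {_~_ = Adjacent H} (Adjacent-sym H) q (λ u → β (j , u)) (λ u → (λ eq → q∉ (u , eq)) , q-all u)
      λ u v u≢v → u≢v ∘ cong proj₂ ∘ injective injection , ⇒ (edges _ _) refl)

  -- A vertex adjacent to all of both blocks would lie in both, but they are disjoint.
  ¬¬-missed : ∀ q t → ¬ ¬ (∃₂ λ b u → ¬ E H q (β ((t , b) , u)))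
  ¬¬-missed q t k =
    ¬¬-∀Fin (λ u no → k (false , u , no)) λ all₀ →
    ¬¬-∀Fin (λ u no → k (true , u , no)) λ all₁ →
    ¬¬-in-block (t , false) all₀ λ (u , eq₀) →
    ¬¬-in-block (t , true) all₁ λ (v , eq₁) →
    contradiction (cong (proj₂ ∘ proj₁) (injective injection (trans (sym eq₀) eq₁))) λ ()

  -- Independent vertices whose images form a clique.

  module _ (ret : Retraction H)
           (β∈range : ∀ v → Retraction.range ret (β v))
           (range-finite : Finite (Retraction.range ret)) where

    open Retraction ret
    open Hom hom renaming (map to r)

    R : List (V H)
    R = proj₁ range-finite

    r∈R : ∀ x → r x ∈ R
    r∈R x = ⇒ (proj₂ range-finite _) (x , refl)

    r-β : ∀ v → r (β v) ≡ β v
    r-β v with x , rx≡βv ← β∈range v = subst (λ y → r y ≡ y) rx≡βv (idempotent x)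

    β∈R : ∀ v → β v ∈ R
    β∈R v = subst (_∈ R) (r-β v) (r∈R (β v))

    Spread : Rel (V H) 0ℓ
    Spread x y = ¬ E H x y × Adjacent H (r x) (r y)

    Spread-sym : Symmetric Spread
    Spread-sym (¬xy , rxy) = ¬xy ∘ E-sym H , Adjacent-sym H rxy

    -- The field `late` prepares the last step: it controls adjacency to the blocks from which the
    -- final `z` will be chosen.
    record Independent (k : ℕ) : Set where
      field
        a      : Fin k → V H
        a∉R    : ∀ i → ¬ a i ∈ R
        spread : Pairwise Spread a
        late   : ∀ i t b u → let w = β ((suc t , b) , u) in E H (a i) w → ∃[ j ] w ≡ r (a j)

    -- A vertex z of R not adjacent to r y keeps the image of any common
    -- neighbour of z and y away from r y.
    image-adjacent : ∀ {x y} v → ¬ E H (r y) (β v) → E H x (β v) → E H x y → Adjacent H (r x) (r y)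
    image-adjacent v ry≁v x~v x~y =
      (λ eq → ry≁v (subst₂ (E H) eq (r-β v) (preserve x~v))) , preserve x~y

    Missed : ∀ {k} → (Fin k → V H) → (Fin k → Fin (suc m)) → Set
    Missed a t = ∀ i → ∃₂ λ b u → ¬ E H (r (a i)) (β ((t i , b) , u))

    ¬¬-Missed : ∀ {k} (a : Fin k → V H) t → ¬ ¬ Missed a t
    ¬¬-Missed a t = ¬¬-∀Fin λ i → ¬¬-missed (r (a i)) (t i)

    module Extend {k} (k<m : k < m) (ind : Independent k)
                  (missed : Missed (Independent.a ind) (λ _ → zero)) where

      open Independent ind

      z : Fin k → J × Fin m
      z i = (zero , proj₁ (missed i)) , proj₁ (proj₂ (missed i))

      ra≁z : ∀ i → ¬ E H (r (a i)) (β (z i))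
      ra≁z i = proj₂ (proj₂ (missed i))

      At : Fin k → Pred (V H) 0ℓ
      At i y = y ≡ r (a i) ⊎ y ≡ β (z i)

      S : Pred (V H) 0ℓ
      S y = ∃[ i ] At i y

      At-nonadjacent : ∀ {i x y} → At i x → At i y → ¬ Adjacent H x y
      At-nonadjacent     (inj₁ refl) (inj₁ refl) (x≢x , _) = x≢x refl
      At-nonadjacent {i} (inj₁ refl) (inj₂ refl) (_ , e)   = ra≁z i e
      At-nonadjacent {i} (inj₂ refl) (inj₁ refl) (_ , e)   = ra≁z i (E-sym H e)
      At-nonadjacent     (inj₂ refl) (inj₂ refl) (x≢x , _) = x≢x refl

      S-free : CliqueFree H m S
      S-free f f∈S clique with i , j , i<j , eq ← pigeonhole k<m (proj₁ ∘ f∈S) =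
        At-nonadjacent (subst (λ h → At h (f i)) eq (proj₂ (f∈S i))) (proj₂ (f∈S j))
          (clique i j (<⇒≢ i<j))

      S⊆R : ∀ {y} → S y → y ∈ R
      S⊆R (i , inj₁ refl) = r∈R (a i)
      S⊆R (i , inj₂ refl) = β∈R (z i)

      extended : ∀ {x} → (∀ {y} → y ∈ R ++ tabulate a → x ≢ y × (E H x y ⇔ S y)) →
                 Independent (suc k)
      extended {x} x-ys = record
        { a      = x Vector.∷ a
        ; a∉R    = λ where
            -- All of `R` is among the prescribed vertices, so `x` in `R` would differ from itself.
            zero    x∈R → proj₁ (x-ys (∈-++⁺ˡ x∈R)) refl
            (suc i)     → a∉R i
        ; spread = pairwise-∷ {_~_ = Spread} Spread-sym x a x-spread spread
        ; late   = λ where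
            zero    t b u x~w → x-late (⇒ (proj₂ (x-ys (∈-++⁺ˡ (β∈R _)))) x~w)
            (suc i) t b u a~w → let j , eq = late i t b u a~w in suc j , eq
        }
        where
        x~ : ∀ {y} → S y → E H x y
        x~ s = ⇐ (proj₂ (x-ys (∈-++⁺ˡ (S⊆R s)))) s

        x-spread : ∀ i → Spread x (a i)
        x-spread i =
          -- Adjacency would put `a i` into `S`, hence into `R`.
          (λ x~a → a∉R i (S⊆R (⇒ (proj₂ (x-ys (∈-++⁺ʳ R (∈-tabulate⁺ i)))) x~a))) ,
          -- Here `x` is a neighbour of `r (a i)`, not of `a i`; idempotence identifies the image of
          -- `r (a i)`.
          subst (Adjacent H (r x)) (idempotent (a i))
            (image-adjacent (z i) (subst (λ y → ¬ E H y (β (z i))) (sym (idempotent (a i))) (ra≁z i))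
              (x~ (i , inj₂ refl)) (x~ (i , inj₁ refl)))

        x-late : ∀ {t b u} → let w = β ((suc t , b) , u) in
                 S w → ∃[ j ] w ≡ r ((x Vector.∷ a) j)
        x-late (i , inj₁ eq) = suc i , eq
        x-late (i , inj₂ eq) =
          -- The vertex `z i` comes from pair `zero`, not from a pair `suc t`.
          contradiction (sym (cong (proj₁ ∘ proj₁) (injective injection eq))) 0≢1+n

    extend : ∀ {k} → k < m → Independent k → ¬ ¬ Independent (suc k)
    extend k<m ind ¬next =
      ¬¬-Missed (Independent.a ind) (λ _ → zero) λ missed →
      let open Extend k<m ind missed in
      ¬¬-extension henson S S-free (R ++ tabulate (Independent.a ind)) λ (x , x-ys) →
      ¬next (extended x-ys)

    ¬¬-independent : ∀ k → k ≤ m → ¬ ¬ Independent k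
    ¬¬-independent zero    _   ¬ind =
      ¬ind (record { a = λ () ; a∉R = λ () ; spread = λ () ; late = λ () })
    ¬¬-independent (suc k) k<m ¬ind =
      ¬¬-independent k (<⇒≤ k<m) λ ind → extend k<m ind ¬ind

    -- The last vertex and the forbidden clique.

    module Finish (ind : Independent m) (missed : Missed (Independent.a ind) suc) where

      open Independent ind

      z : Fin m → J × Fin m
      z i = (suc i , proj₁ (missed i)) , proj₁ (proj₂ (missed i))

      ra≁z : ∀ i → ¬ E H (r (a i)) (β (z i))
      ra≁z i = proj₂ (proj₂ (missed i))

      ra~ra : ∀ i j → E H (r (a i)) (r (a j))
      ra~ra i j with i ≟ j
      ... | yes refl = E-refl H
      ... | no  i≢j  = proj₂ (proj₂ (spread i j i≢j))

      a≁z : ∀ i j → ¬ E H (a i) (β (z j))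
      a≁z i j a~z with h , eq ← late i j _ _ a~z =
        ra≁z j (subst (E H (r (a j))) (sym eq) (ra~ra j h))

      S : Pred (V H) 0ℓ
      S y = ∃[ i ] (y ≡ a i ⊎ y ≡ β (z i))

      S-independent : ∀ {x y} → S x → S y → ¬ Adjacent H x y
      S-independent (i , inj₁ refl) (j , inj₁ refl) (x≢y , e) =
        proj₁ (spread i j (x≢y ∘ cong a)) e
      S-independent (i , inj₁ refl) (j , inj₂ refl) (_ , e) = a≁z i j e
      S-independent (i , inj₂ refl) (j , inj₁ refl) (_ , e) = a≁z j i (E-sym H e)
      S-independent (i , inj₂ refl) (j , inj₂ refl) (x≢y , e) =
        -- Adjacent block vertices share a block, and the block of `z i` determines `i`.
        x≢y (cong (β ∘ z) (Fin-suc-injective (cong proj₁ (⇐ (edges (z i) (z j)) e))))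

      S-free : CliqueFree H m S
      -- The constant map to `Fin 1` just produces two distinct indices below `m`; this is where
      -- `2 ≤ m` enters.
      S-free f f∈S clique with i , j , i<j , _ ← pigeonhole 2≤m (λ _ → zero {0}) =
        S-independent (f∈S i) (f∈S j) (clique i j (<⇒≢ i<j))

      no-extension : ¬ (∃[ x ] (∀ {y} → y ∈ tabulate a ++ R → x ≢ y × (E H x y ⇔ S y)))
      no-extension (x , x-ys) = KFree⇒no-clique H free
        (pairwise-∷ {_~_ = Adjacent H} (Adjacent-sym H) (r x) (r ∘ a)
          (λ i → image-adjacent (z i) (ra≁z i)
            (⇐ (proj₂ (x-ys (∈-++⁺ʳ (tabulate a) (β∈R (z i))))) (i , inj₂ refl))
            (⇐ (proj₂ (x-ys (∈-++⁺ˡ (∈-tabulate⁺ i)))) (i , inj₁ refl)))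
          λ i j i≢j → proj₂ (spread i j i≢j))

    impossible : ⊥
    impossible =
      ¬¬-independent m ≤-refl λ ind →
      ¬¬-Missed (Independent.a ind) suc λ missed →
      let open Finish ind missed in
      ¬¬-extension henson S S-free (tabulate (Independent.a ind) ++ R) no-extension

  not-retractable : ¬ FinitelyRetractable H
  not-retractable retractable
    with ret , F⊆range , finite ← retractable (_∈ map β vertices) (map β vertices , λ _ → mk⇔ id id) =
    impossible ret (λ v → F⊆range (∈-map⁺ β (∈-vertices v))) finite

theorem8p1 : (l : ℕ) → 2 < l → (H : Graph) → IsHenson l H → ¬ FinitelyRetractable H
theorem8p1 (suc m) (s≤s 2≤m) H henson = Contradiction.not-retractable 2≤m henson
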